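{- The following two statements are equivalent. (i) The grammar $G$ is totally ambiguous: for every $n\ge 1$ and every pair $T_1,T_2$ of $n$-leaf binary trees there is a word $w$ of length $n$ on $\{0,1,2\}$ parsed by both $T_1$ and $T_2$. (ii) For every $n\ge 1$ and every pair of $n$-bracketings there exists an $n$-tuple $(v_1,\dots,v_n)\in\{\hat\imath,\hat\jmath,\hat k\}^n$ such that the two bracketings of $v_1\times v_2\times\cdots\times v_n$ evaluate to the same nonzero vector of $\mathbb{R}^3$.
   Context: A binary tree is a rooted ordered tree in which each vertex has either $0$ or $2$ children; its leaves are ordered left to right. Let $G$ be the context-free grammar with start symbols $0,1,2$ and rules $0\to 12$, $0\to 21$, $1\to 02$, $1\to 20$, $2\to 01$, $2\to 10$. An $n$-leaf binary tree $T$ parses a word $w$ of length $n$ on $\{0,1,2\}$ if there is a labeling of the vertices of $T$ by $0,1,2$ such that the leaves, from left to right, are labeled with the letters of $w$, and at every internal vertex the label of the vertex together with the labels of its left and right children form a rule of $G$ (i.e. the three labels are pairwise distinct). $\hat\imath,\hat\jmath,\hat k$ are the standard unit vectors of $\mathbb{R}^3$ and $\times$ is the cross product, which is not associative. An $n$-bracketing is a full parenthesization of the expression $v_1\times v_2\times\cdots\times v_n$ (keeping the order of the factors), specifying how the $n-1$ binary cross products are to be computed; $n$-bracketings are in bijection with $n$-leaf binary trees, the leaves being assigned $v_1,\dots,v_n$ from left to right and each internal vertex being assigned the cross product (left child) $\times$ (right child). -}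

module Defs where

open import Data.Fin.Base using (Fin)
open import Data.Fin.Patterns using (0F; 1F; 2F)
open import Data.List.Base as List using (List)
open import Data.List.Membership.Propositional using (_∈_)
open import Data.Nat.Base as ℕ using (ℕ)
import Data.Nat.Properties as ℕ
open import Data.Product.Base using (∃-syntax; _×_; _,_)
open import Data.Rational.Base as ℚ using (ℚ; 0ℚ; 1ℚ; ½)
import Data.Rational.Properties as ℚ
import Data.Rational.Solver as ℚ
open import Data.Unit.Base using (⊤)
open import Data.Vec.Base using (Vec; []; _∷_; _++_; take; drop)
open import Data.Vec.Relation.Binary.Pointwise.Inductive using (Pointwise)
open import Data.Vec.Relation.Unary.All using (All)
open import Function.Base using (_∘_)
open import Relation.Binary.PropositionalEquality
  using (_≡_; refl; sym; trans; cong; subst)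
open import Relation.Nullary.Negation.Core using (¬_)

private
  variable
    m n : ℕ

------------------------------------------------------------------------
-- Binary trees, the grammar G and parsing

-- Indexed by the number of leaves.
data BinaryTree : ℕ → Set where
  leaf : BinaryTree 1
  node : BinaryTree m → BinaryTree n → BinaryTree (m ℕ.+ n)

data Vertex : BinaryTree n → Set where
  root    : {t : BinaryTree n} → Vertex t
  inLeft  : {l : BinaryTree m} {r : BinaryTree n} → Vertex l → Vertex (node l r)
  inRight : {l : BinaryTree m} {r : BinaryTree n} → Vertex r → Vertex (node l r)

Symbol : Set
Symbol = Fin 3

infix 4 _⟶_,_

data _⟶_,_ : Symbol → Symbol → Symbol → Set where
  0⟶12 : 0F ⟶ 1F , 2F
  0⟶21 : 0F ⟶ 2F , 1F
  1⟶02 : 1F ⟶ 0F , 2F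
  1⟶20 : 1F ⟶ 2F , 0F
  2⟶01 : 2F ⟶ 0F , 1F
  2⟶10 : 2F ⟶ 1F , 0F

Word : ℕ → Set
Word n = Vec Symbol n

Labeling : BinaryTree n → Set
Labeling t = Vertex t → Symbol

leafWord : (t : BinaryTree n) → Labeling t → Word n
leafWord leaf       ℓ = ℓ root ∷ []
leafWord (node l r) ℓ = leafWord l (ℓ ∘ inLeft) ++ leafWord r (ℓ ∘ inRight)

ObeysRules : (t : BinaryTree n) → Labeling t → Set
ObeysRules leaf       ℓ = ⊤
ObeysRules (node l r) ℓ =
  (ℓ root ⟶ ℓ (inLeft root) , ℓ (inRight root)) ×
  ObeysRules l (ℓ ∘ inLeft) ×
  ObeysRules r (ℓ ∘ inRight)

Parses : BinaryTree n → Word n → Set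
Parses t w = ∃[ ℓ ] leafWord t ℓ ≡ w × ObeysRules t ℓ

TotallyAmbiguous : Set
TotallyAmbiguous =
  ∀ n → n ℕ.≥ 1 → (t₁ t₂ : BinaryTree n) →
  ∃[ w ] Parses t₁ w × Parses t₂ w

------------------------------------------------------------------------
-- The real numbers, as Cauchy sequences of rationals.  Equality of reals
-- is _≃_ below, not _≡_.

record ℝ : Set where
  field
    seq    : ℕ → ℚ
    cauchy : ∀ ε → 0ℚ ℚ.< ε →
             ∃[ N ] ∀ m n → N ℕ.≤ m → N ℕ.≤ n → ℚ.∣ seq m ℚ.- seq n ∣ ℚ.< ε

open ℝ public

infix 4 _≃_

_≃_ : ℝ → ℝ → Set
x ≃ y = ∀ ε → 0ℚ ℚ.< ε →
        ∃[ N ] ∀ n → N ℕ.≤ n → ℚ.∣ seq x n ℚ.- seq y n ∣ ℚ.< ε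

fromℚ : ℚ → ℝ
fromℚ q .seq    _     = q
fromℚ q .cauchy ε 0<ε = 0 , λ _ _ _ _ →
  subst (λ d → ℚ.∣ d ∣ ℚ.< ε) (sym (ℚ.+-inverseʳ q)) 0<ε

0ℝ 1ℝ : ℝ
0ℝ = fromℚ 0ℚ
1ℝ = fromℚ 1ℚ

module _ (ε : ℚ) where

  half+half : ½ ℚ.* ε ℚ.+ ½ ℚ.* ε ≡ ε
  half+half = trans (sym (ℚ.*-distribʳ-+ ε ½ ½)) (ℚ.*-identityˡ ε)

  0<half : 0ℚ ℚ.< ε → 0ℚ ℚ.< ½ ℚ.* ε
  0<half 0<ε = subst (ℚ._< ½ ℚ.* ε) (ℚ.*-zeroʳ ½) (ℚ.*-monoʳ-<-pos ½ 0<ε)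

  half< : 0ℚ ℚ.< ε → ½ ℚ.* ε ℚ.< ε
  half< 0<ε = begin-strict
    ½ ℚ.* ε               ≡⟨ ℚ.+-identityˡ _ ⟨
    0ℚ ℚ.+ ½ ℚ.* ε        <⟨ ℚ.+-monoˡ-< (½ ℚ.* ε) (0<half 0<ε) ⟩
    ½ ℚ.* ε ℚ.+ ½ ℚ.* ε   ≡⟨ half+half ⟩
    ε                     ∎
    where open ℚ.≤-Reasoning

infixl 6 _+_ _-_
infixl 7 _*_
infix  8 -_

_+_ : ℝ → ℝ → ℝ
(x + y) .seq n = seq x n ℚ.+ seq y n
(x + y) .cauchy ε 0<ε
  with N₁ , p₁ ← cauchy x (½ ℚ.* ε) (0<half ε 0<ε)
     | N₂ , p₂ ← cauchy y (½ ℚ.* ε) (0<half ε 0<ε)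
  = N₁ ℕ.⊔ N₂ , λ m n N≤m N≤n → begin-strict
    ℚ.∣ (seq x m ℚ.+ seq y m) ℚ.- (seq x n ℚ.+ seq y n) ∣
      ≡⟨ cong ℚ.∣_∣ (rearrange (seq x m) (seq y m) (seq x n) (seq y n)) ⟩
    ℚ.∣ (seq x m ℚ.- seq x n) ℚ.+ (seq y m ℚ.- seq y n) ∣
      ≤⟨ ℚ.∣p+q∣≤∣p∣+∣q∣ (seq x m ℚ.- seq x n) (seq y m ℚ.- seq y n) ⟩
    ℚ.∣ seq x m ℚ.- seq x n ∣ ℚ.+ ℚ.∣ seq y m ℚ.- seq y n ∣
      <⟨ ℚ.+-mono-<
           (p₁ m n (ℕ.m⊔n≤o⇒m≤o N₁ N₂ N≤m) (ℕ.m⊔n≤o⇒m≤o N₁ N₂ N≤n))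
           (p₂ m n (ℕ.m⊔n≤o⇒n≤o N₁ N₂ N≤m) (ℕ.m⊔n≤o⇒n≤o N₁ N₂ N≤n)) ⟩
    ½ ℚ.* ε ℚ.+ ½ ℚ.* ε
      ≡⟨ half+half ε ⟩
    ε ∎
  where
  open ℚ.≤-Reasoning
  rearrange : ∀ a b c d → (a ℚ.+ b) ℚ.- (c ℚ.+ d) ≡ (a ℚ.- c) ℚ.+ (b ℚ.- d)
  rearrange = solve 4
    (λ a b c d → (a :+ b) :- (c :+ d) := (a :- c) :+ (b :- d)) refl
    where open ℚ.+-*-Solver

-_ : ℝ → ℝ
(- x) .seq n = ℚ.- seq x n
(- x) .cauchy ε 0<ε with N , p ← cauchy x ε 0<ε
  = N , λ m n N≤m N≤n → subst (ℚ._< ε) (flip-sign (seq x m) (seq x n)) (p m n N≤m N≤n)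
  where
  flip-sign : ∀ a b → ℚ.∣ a ℚ.- b ∣ ≡ ℚ.∣ ℚ.- a ℚ.- ℚ.- b ∣
  flip-sign a b = trans (sym (ℚ.∣-p∣≡∣p∣ (a ℚ.- b)))
                        (cong ℚ.∣_∣ (ℚ.neg-distrib-+ a (ℚ.- b)))

_-_ : ℝ → ℝ → ℝ
x - y = x + (- y)

abstract

  eventuallyBounded : (x : ℝ) →
    ∃[ B ] 0ℚ ℚ.< B × (∃[ N ] ∀ n → N ℕ.≤ n → ℚ.∣ seq x n ∣ ℚ.≤ B)
  eventuallyBounded x
    with N , p ← cauchy x 1ℚ (ℚ.positive⁻¹ 1ℚ)
    = 1ℚ ℚ.+ ℚ.∣ seq x N ∣
    , ℚ.+-mono-<-≤ (ℚ.positive⁻¹ 1ℚ) (ℚ.0≤∣p∣ (seq x N))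
    , N
    , λ n N≤n → begin
      ℚ.∣ seq x n ∣
        ≡⟨ cong ℚ.∣_∣ (split (seq x n) (seq x N)) ⟩
      ℚ.∣ (seq x n ℚ.- seq x N) ℚ.+ seq x N ∣
        ≤⟨ ℚ.∣p+q∣≤∣p∣+∣q∣ (seq x n ℚ.- seq x N) (seq x N) ⟩
      ℚ.∣ seq x n ℚ.- seq x N ∣ ℚ.+ ℚ.∣ seq x N ∣
        ≤⟨ ℚ.+-monoˡ-≤ ℚ.∣ seq x N ∣ (ℚ.<⇒≤ (p n N N≤n ℕ.≤-refl)) ⟩
      1ℚ ℚ.+ ℚ.∣ seq x N ∣ ∎
    where
    open ℚ.≤-Reasoning
    split : ∀ a b → a ≡ (a ℚ.- b) ℚ.+ b
    split = solve 2 (λ a b → a := (a :- b) :+ b) refl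
      where open ℚ.+-*-Solver

  ∣*∣-mono-≤ : ∀ {p q a b} → 0ℚ ℚ.< a → ℚ.∣ p ∣ ℚ.≤ a → ℚ.∣ q ∣ ℚ.≤ b →
               ℚ.∣ p ℚ.* q ∣ ℚ.≤ a ℚ.* b
  ∣*∣-mono-≤ {p} {q} {a} {b} 0<a p≤a q≤b = begin
    ℚ.∣ p ℚ.* q ∣         ≡⟨ ℚ.∣p*q∣≡∣p∣*∣q∣ p q ⟩
    ℚ.∣ p ∣ ℚ.* ℚ.∣ q ∣   ≤⟨ ℚ.*-monoʳ-≤-nonNeg ℚ.∣ q ∣ {{ℚ.∣-∣-nonNeg q}} p≤a ⟩
    a ℚ.* ℚ.∣ q ∣         ≤⟨ ℚ.*-monoˡ-≤-nonNeg a {{ℚ.nonNegative (ℚ.<⇒≤ 0<a)}} q≤b ⟩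
    a ℚ.* b               ∎
    where open ℚ.≤-Reasoning

  ∣Δ*∣-bound : ∀ {A B δ} a b c d → 0ℚ ℚ.< A → 0ℚ ℚ.< B →
               ℚ.∣ a ∣ ℚ.≤ A → ℚ.∣ d ∣ ℚ.≤ B →
               ℚ.∣ a ℚ.- c ∣ ℚ.≤ δ → ℚ.∣ b ℚ.- d ∣ ℚ.≤ δ →
               ℚ.∣ a ℚ.* b ℚ.- c ℚ.* d ∣ ℚ.≤ (A ℚ.+ B) ℚ.* δ
  ∣Δ*∣-bound {A} {B} {δ} a b c d 0<A 0<B a≤A d≤B Δ₁≤δ Δ₂≤δ = begin
    ℚ.∣ a ℚ.* b ℚ.- c ℚ.* d ∣
      ≡⟨ cong ℚ.∣_∣ (rearrange a b c d) ⟩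
    ℚ.∣ a ℚ.* (b ℚ.- d) ℚ.+ d ℚ.* (a ℚ.- c) ∣
      ≤⟨ ℚ.∣p+q∣≤∣p∣+∣q∣ (a ℚ.* (b ℚ.- d)) (d ℚ.* (a ℚ.- c)) ⟩
    ℚ.∣ a ℚ.* (b ℚ.- d) ∣ ℚ.+ ℚ.∣ d ℚ.* (a ℚ.- c) ∣
      ≤⟨ ℚ.+-mono-≤ (∣*∣-mono-≤ {a} {b ℚ.- d} 0<A a≤A Δ₂≤δ)
                    (∣*∣-mono-≤ {d} {a ℚ.- c} 0<B d≤B Δ₁≤δ) ⟩
    A ℚ.* δ ℚ.+ B ℚ.* δ
      ≡⟨ ℚ.*-distribʳ-+ δ A B ⟨
    (A ℚ.+ B) ℚ.* δ ∎
    where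
    open ℚ.≤-Reasoning
    rearrange : ∀ a b c d →
      (a ℚ.* b) ℚ.- (c ℚ.* d) ≡ (a ℚ.* (b ℚ.- d)) ℚ.+ (d ℚ.* (a ℚ.- c))
    rearrange = solve 4
      (λ a b c d → (a :* b) :- (c :* d) := (a :* (b :- d)) :+ (d :* (a :- c))) refl
      where open ℚ.+-*-Solver

  divideTolerance : ∀ C ε → 0ℚ ℚ.< C → 0ℚ ℚ.< ε → ∃[ δ ] 0ℚ ℚ.< δ × C ℚ.* δ ℚ.< ε
  divideTolerance C ε 0<C 0<ε = δ , 0<δ , subst (ℚ._< ε) (sym C*δ) (half< ε 0<ε)
    where
    instance
      C-positive : ℚ.Positive C
      C-positive = ℚ.positive 0<C
      C-nonZero : ℚ.NonZero C
      C-nonZero = ℚ.pos⇒nonZero C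

    δ : ℚ
    δ = ℚ.1/ C ℚ.* (½ ℚ.* ε)

    0<δ : 0ℚ ℚ.< δ
    0<δ = ℚ.positive⁻¹ δ
      {{ℚ.pos*pos⇒pos (ℚ.1/ C) {{ℚ.1/pos⇒pos C}}
                      (½ ℚ.* ε) {{ℚ.positive (0<half ε 0<ε)}}}}

    C*δ : C ℚ.* δ ≡ ½ ℚ.* ε
    C*δ = trans (sym (ℚ.*-assoc C (ℚ.1/ C) (½ ℚ.* ε)))
         (trans (cong (ℚ._* (½ ℚ.* ε)) (ℚ.*-inverseʳ C)) (ℚ.*-identityˡ (½ ℚ.* ε)))

  *-cauchy : (x y : ℝ) → ∀ ε → 0ℚ ℚ.< ε →
             ∃[ N ] ∀ m n → N ℕ.≤ m → N ℕ.≤ n →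
               ℚ.∣ seq x m ℚ.* seq y m ℚ.- seq x n ℚ.* seq y n ∣ ℚ.< ε
  *-cauchy x y ε 0<ε = bounds (eventuallyBounded x) (eventuallyBounded y)
    where
    Goal : Set
    Goal = ∃[ N ] ∀ m n → N ℕ.≤ m → N ℕ.≤ n →
             ℚ.∣ seq x m ℚ.* seq y m ℚ.- seq x n ℚ.* seq y n ∣ ℚ.< ε

    EventualBound : ℝ → Set
    EventualBound z =
      ∃[ B ] 0ℚ ℚ.< B × (∃[ N ] ∀ n → N ℕ.≤ n → ℚ.∣ seq z n ∣ ℚ.≤ B)

    Close : ℝ → ℚ → Set
    Close z δ = ∃[ N ] ∀ m n → N ℕ.≤ m → N ℕ.≤ n → ℚ.∣ seq z m ℚ.- seq z n ∣ ℚ.< δ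

    bounds : EventualBound x → EventualBound y → Goal
    bounds (A , 0<A , M₁ , x≤A) (B , 0<B , M₂ , y≤B) =
      tolerance (divideTolerance (A ℚ.+ B) ε (ℚ.+-mono-< 0<A 0<B) 0<ε)
      where
      close : ∀ {δ} → (A ℚ.+ B) ℚ.* δ ℚ.< ε → Close x δ → Close y δ → Goal
      close C*δ<ε (N₁ , p₁) (N₂ , p₂) =
        M ℕ.⊔ N , λ m n ≤m ≤n →
        let M≤m = ℕ.m⊔n≤o⇒m≤o M N ≤m
            M≤n = ℕ.m⊔n≤o⇒m≤o M N ≤n
            N≤m = ℕ.m⊔n≤o⇒n≤o M N ≤m
            N≤n = ℕ.m⊔n≤o⇒n≤o M N ≤n
        in ℚ.≤-<-trans
          (∣Δ*∣-bound (seq x m) (seq y m) (seq x n) (seq y n) 0<A 0<B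
            (x≤A m (ℕ.m⊔n≤o⇒m≤o M₁ M₂ M≤m))
            (y≤B n (ℕ.m⊔n≤o⇒n≤o M₁ M₂ M≤n))
            (ℚ.<⇒≤ (p₁ m n (ℕ.m⊔n≤o⇒m≤o N₁ N₂ N≤m) (ℕ.m⊔n≤o⇒m≤o N₁ N₂ N≤n)))
            (ℚ.<⇒≤ (p₂ m n (ℕ.m⊔n≤o⇒n≤o N₁ N₂ N≤m) (ℕ.m⊔n≤o⇒n≤o N₁ N₂ N≤n))))
          C*δ<ε
        where
        M N : ℕ
        M = M₁ ℕ.⊔ M₂
        N = N₁ ℕ.⊔ N₂

      tolerance : (∃[ δ ] 0ℚ ℚ.< δ × (A ℚ.+ B) ℚ.* δ ℚ.< ε) → Goal
      tolerance (δ , 0<δ , C*δ<ε) = close C*δ<ε (cauchy x δ 0<δ) (cauchy y δ 0<δ)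

_*_ : ℝ → ℝ → ℝ
(x * y) .seq n  = seq x n ℚ.* seq y n
(x * y) .cauchy = *-cauchy x y

------------------------------------------------------------------------
-- Vectors in ℝ³ and bracketed cross products

ℝ³ : Set
ℝ³ = Vec ℝ 3

infix 4 _≋_

_≋_ : ℝ³ → ℝ³ → Set
_≋_ = Pointwise _≃_

0⃗ î ĵ k̂ : ℝ³
0⃗ = 0ℝ ∷ 0ℝ ∷ 0ℝ ∷ []
î = 1ℝ ∷ 0ℝ ∷ 0ℝ ∷ []
ĵ = 0ℝ ∷ 1ℝ ∷ 0ℝ ∷ []
k̂ = 0ℝ ∷ 0ℝ ∷ 1ℝ ∷ []

standardUnitVectors : List ℝ³
standardUnitVectors = î List.∷ ĵ List.∷ k̂ List.∷ List.[]

infixl 7 _⨯_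

_⨯_ : ℝ³ → ℝ³ → ℝ³
(a₁ ∷ a₂ ∷ a₃ ∷ []) ⨯ (b₁ ∷ b₂ ∷ b₃ ∷ []) =
  (a₂ * b₃ - a₃ * b₂) ∷
  (a₃ * b₁ - a₁ * b₃) ∷
  (a₁ * b₂ - a₂ * b₁) ∷ []

-- A full parenthesization of v₁ ⨯ ⋯ ⨯ vₙ is given by its syntax tree.
Bracketing : ℕ → Set
Bracketing = BinaryTree

evaluate : Bracketing n → Vec ℝ³ n → ℝ³
evaluate leaf               (v ∷ []) = v
evaluate (node {m = m} l r) vs       =
  evaluate l (take m vs) ⨯ evaluate r (drop m vs)

-- Membership of each vᵢ in {î, ĵ, k̂} is up to _≡_ rather than _≋_; under the
-- existential this loses nothing, since representatives may be chosen freely.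
AgreeNonzeroOnUnitVectors : Set
AgreeNonzeroOnUnitVectors =
  ∀ n → n ℕ.≥ 1 → (b₁ b₂ : Bracketing n) →
  ∃[ vs ] All (_∈ standardUnitVectors) vs ×
          evaluate b₁ vs ≋ evaluate b₂ vs ×
          ¬ (evaluate b₁ vs ≋ 0⃗)

{-# OPTIONS --safe #-}

-- The product of two distinct standard unit vectors in the quaternion group
-- is their cross product.  So if a tree parses a word, evaluating the
-- corresponding bracketing at the corresponding unit vectors gives the
-- quaternion product of the word, namely plus or minus the unit vector of the
-- root label.  That product is associative, so any two trees parsing the same
-- word evaluate to the same nonzero vector.  If a tree does not parse a word,
-- some cross product of two parallel vectors occurs, and the value is zero.
module Submission where

open import Defs
open import Data.Empty using (⊥-elim)
open import Data.Fin.Base using (Fin; suc)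
open import Data.Fin.Patterns using (0F; 1F; 2F; 3F)
open import Data.Fin.Properties using (all?; suc-injective) renaming (_≟_ to _≟ᶠ_)
open import Data.List.Membership.Propositional using (_∈_)
open import Data.List.Relation.Unary.Any using (here; there)
open import Data.Nat.Base as ℕ using (ℕ)
import Data.Nat.Properties as ℕ
open import Data.Product.Base using (∃-syntax; _×_; _,_)
open import Data.Product.Properties using (≡-dec; ,-injective)
open import Data.Rational.Base as ℚ using (ℚ; 0ℚ; 1ℚ)
import Data.Rational.Properties as ℚ
import Data.Rational.Solver as ℚ
open import Data.Sign.Base as Sign using (Sign)
import Data.Sign.Properties as Sign
open import Data.Sum.Base using (_⊎_; inj₁; inj₂)
open import Data.Unit.Base using (tt)
open import Data.Vec.Base using (Vec; []; _∷_; _++_; take; drop; map; foldr′; splitAt)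
open import Data.Vec.Properties using (++-injective; take++drop≡id; map-++; map-cong; map-∘)
open import Data.Vec.Relation.Binary.Pointwise.Inductive using (Pointwise; []; _∷_; Pointwise-≡⇒≡)
open import Data.Vec.Relation.Unary.All as All using (All; []; _∷_)
open import Data.Vec.Relation.Unary.All.Properties using (map⁺)
open import Function.Base using (_∘_)
open import Function.Bundles using (_⇔_; mk⇔)
open import Relation.Binary.PropositionalEquality
  using (_≡_; refl; sym; trans; cong; cong₂; subst; subst₂; module ≡-Reasoning)
open import Relation.Nullary.Decidable.Core using (Dec; yes; no; from-yes)
open import Relation.Nullary.Negation.Core using (¬_)

import Algebra.Properties.Group ℚ.+-0-group as ℚ+

private
  variable
    m n : ℕ
    a b c : Symbol

-- Labeled trees

-- Positive exactly when `a`, `b`, `c` is a cyclic rotation of 0, 1, 2: the sign in both the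
-- quaternion identity and the cross product identity `ab = ±c`.
ruleSign : c ⟶ a , b → Sign
ruleSign 0⟶12 = Sign.+
ruleSign 0⟶21 = Sign.-
ruleSign 1⟶02 = Sign.-
ruleSign 1⟶20 = Sign.+
ruleSign 2⟶01 = Sign.+
ruleSign 2⟶10 = Sign.-

-- Two labeled subtrees fail to join under a rule only when their root labels coincide, which is
-- when the cross product of their values vanishes.
equal-or-rule : ∀ a b → a ≡ b ⊎ ∃[ c ] c ⟶ a , b
equal-or-rule 0F 0F = inj₁ refl
equal-or-rule 0F 1F = inj₂ (2F , 2⟶01)
equal-or-rule 0F 2F = inj₂ (1F , 1⟶02)
equal-or-rule 1F 0F = inj₂ (2F , 2⟶10)
equal-or-rule 1F 1F = inj₁ refl
equal-or-rule 1F 2F = inj₂ (0F , 0⟶12)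
equal-or-rule 2F 0F = inj₂ (1F , 1⟶20)
equal-or-rule 2F 1F = inj₂ (0F , 0⟶21)
equal-or-rule 2F 2F = inj₁ refl

treeSign : (t : BinaryTree n) (ℓ : Labeling t) → ObeysRules t ℓ → Sign
treeSign leaf       ℓ _             = Sign.+
treeSign (node l r) ℓ (ρ , ol , or) =
  treeSign l (ℓ ∘ inLeft) ol Sign.* (treeSign r (ℓ ∘ inRight) or Sign.* ruleSign ρ)

joinLabelings : {l : BinaryTree m} {r : BinaryTree n} →
                Symbol → Labeling l → Labeling r → Labeling (node l r)
joinLabelings c ℓ₁ ℓ₂ root        = c
joinLabelings c ℓ₁ ℓ₂ (inLeft v)  = ℓ₁ v
joinLabelings c ℓ₁ ℓ₂ (inRight v) = ℓ₂ v

-- The quaternion group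

-- (s , 0F) is the quaternion ±1 and (s , suc a) is ± the unit of the symbol a.
Q₈ : Set
Q₈ = Sign × Fin 4

1Q : Q₈
1Q = Sign.+ , 0F

infixr 7 _◃_ _•_

_◃_ : Sign → Q₈ → Q₈
s ◃ (t , x) = s Sign.* t , x

-- The quaternion multiplication table, with 0, 1, 2 read as i, j, k on the left and 1, i, j, k on
-- the right.
unitProduct : Symbol → Fin 4 → Q₈
unitProduct a  0F = Sign.+ , suc a
unitProduct 0F 1F = Sign.- , 0F
unitProduct 0F 2F = Sign.+ , 3F
unitProduct 0F 3F = Sign.- , 2F
unitProduct 1F 1F = Sign.- , 3F
unitProduct 1F 2F = Sign.- , 0F
unitProduct 1F 3F = Sign.+ , 1F
unitProduct 2F 1F = Sign.+ , 2F
unitProduct 2F 2F = Sign.- , 1F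
unitProduct 2F 3F = Sign.- , 0F

-- Letting words act by left multiplication makes associativity automatic.
_•_ : Symbol → Q₈ → Q₈
a • (s , x) = s ◃ unitProduct a x

◃-assoc : ∀ s t q → (s Sign.* t) ◃ q ≡ s ◃ t ◃ q
◃-assoc s t (u , x) = cong (_, x) (Sign.*-assoc s t u)

-- Signs are central in the quaternion group.
•-◃-comm : ∀ a s q → a • (s ◃ q) ≡ s ◃ (a • q)
•-◃-comm a s (t , x) = ◃-assoc s t (unitProduct a x)

-- This is the quaternion relation `ab = ±c`, stated for left multiplications. Centrality moves the
-- sign of `q` out of the way, leaving four unsigned units to check.
rule-• : (ρ : c ⟶ a , b) → ∀ q → a • b • q ≡ ruleSign ρ ◃ c • q
rule-• {c} {a} {b} ρ (s , x) = begin
  a • (s ◃ unitProduct b x)                 ≡⟨ •-◃-comm a s (unitProduct b x) ⟩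
  s ◃ (a • unitProduct b x)                 ≡⟨ cong (s ◃_) (table ρ x) ⟩
  s ◃ ruleSign ρ ◃ unitProduct c x          ≡⟨ ◃-assoc s (ruleSign ρ) (unitProduct c x) ⟨
  (s Sign.* ruleSign ρ) ◃ unitProduct c x   ≡⟨ cong (_◃ unitProduct c x) (Sign.*-comm s (ruleSign ρ)) ⟩
  (ruleSign ρ Sign.* s) ◃ unitProduct c x   ≡⟨ ◃-assoc (ruleSign ρ) s (unitProduct c x) ⟩
  ruleSign ρ ◃ s ◃ unitProduct c x          ∎
  where
  open ≡-Reasoning

  table? : ∀ s a b c → Dec (∀ x → a • unitProduct b x ≡ s ◃ unitProduct c x)
  table? s a b c = all? λ x → ≡-dec Sign._≟_ _≟ᶠ_ _ _

  table : ∀ {a b c} (ρ : c ⟶ a , b) →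
          ∀ x → a • unitProduct b x ≡ ruleSign ρ ◃ unitProduct c x
  -- Once the rule is fixed, the sign and all three symbols are closed terms, so the decision over
  -- `Fin 4` evaluates to `yes`.
  table 0⟶12 = from-yes (table? Sign.+ 1F 2F 0F)
  table 0⟶21 = from-yes (table? Sign.- 2F 1F 0F)
  table 1⟶02 = from-yes (table? Sign.- 0F 2F 1F)
  table 1⟶20 = from-yes (table? Sign.+ 2F 0F 1F)
  table 2⟶01 = from-yes (table? Sign.+ 0F 1F 2F)
  table 2⟶10 = from-yes (table? Sign.- 1F 0F 2F)

-- Words acting on the quaternion group

act : Word n → Q₈ → Q₈
act w q = foldr′ _•_ q w

act-++ : ∀ (u : Word m) (v : Word n) q → act (u ++ v) q ≡ act u (act v q)
act-++ []      v q = refl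
act-++ (a ∷ u) v q = cong (a •_) (act-++ u v q)

-- Induction on the tree, with `q` arbitrary because the result of the right subtree becomes the
-- argument of the left one. The left side depends on the word alone, so all parse trees of a word
-- must agree on the right side.
act-leafWord : (t : BinaryTree n) (ℓ : Labeling t) (o : ObeysRules t ℓ) →
               ∀ q → act (leafWord t ℓ) q ≡ treeSign t ℓ o ◃ ℓ root • q
act-leafWord leaf       ℓ _             q = refl
act-leafWord (node l r) ℓ (ρ , ol , or) q = begin
  act (leafWord l ℓₗ ++ leafWord r ℓᵣ) q       ≡⟨ act-++ (leafWord l ℓₗ) (leafWord r ℓᵣ) q ⟩
  act (leafWord l ℓₗ) (act (leafWord r ℓᵣ) q)  ≡⟨ cong (act (leafWord l ℓₗ)) (act-leafWord r ℓᵣ or q) ⟩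
  act (leafWord l ℓₗ) (t ◃ ℓᵣ root • q)        ≡⟨ act-leafWord l ℓₗ ol (t ◃ ℓᵣ root • q) ⟩
  s ◃ ℓₗ root • (t ◃ ℓᵣ root • q)              ≡⟨ cong (s ◃_) (•-◃-comm (ℓₗ root) t (ℓᵣ root • q)) ⟩
  s ◃ t ◃ ℓₗ root • ℓᵣ root • q                ≡⟨ cong (λ p → s ◃ t ◃ p) (rule-• ρ q) ⟩
  s ◃ t ◃ ε ◃ ℓ root • q                       ≡⟨ cong (s ◃_) (◃-assoc t ε (ℓ root • q)) ⟨
  s ◃ (t Sign.* ε) ◃ ℓ root • q                ≡⟨ ◃-assoc s (t Sign.* ε) (ℓ root • q) ⟨
  (s Sign.* (t Sign.* ε)) ◃ ℓ root • q         ∎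
  where
  open ≡-Reasoning
  ℓₗ = ℓ ∘ inLeft
  ℓᵣ = ℓ ∘ inRight
  s  = treeSign l ℓₗ ol
  t  = treeSign r ℓᵣ or
  ε  = ruleSign ρ

-- act w 1Q recovers both the sign and the root label.
leafWord-determines-root :
  (t₁ t₂ : BinaryTree n) (ℓ₁ : Labeling t₁) (ℓ₂ : Labeling t₂)
  (o₁ : ObeysRules t₁ ℓ₁) (o₂ : ObeysRules t₂ ℓ₂) →
  leafWord t₁ ℓ₁ ≡ leafWord t₂ ℓ₂ →
  treeSign t₁ ℓ₁ o₁ ≡ treeSign t₂ ℓ₂ o₂ × ℓ₁ root ≡ ℓ₂ root
leafWord-determines-root t₁ t₂ ℓ₁ ℓ₂ o₁ o₂ eq
  with signs , roots ← ,-injective (trans (sym (act-leafWord t₁ ℓ₁ o₁ 1Q))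
                              (trans (cong (λ w → act w 1Q) eq) (act-leafWord t₂ ℓ₂ o₂ 1Q)))
  -- Acting on `1Q` leaves a trailing factor `Sign.+` on each sign and the unit `suc` of each root
  -- label.
  = Sign.*-cancelʳ-≡ Sign.+ _ _ signs , suc-injective roots

-- Vectors with rational coordinates

ℚ³ : Set
ℚ³ = Vec ℚ 3

infix  4 _≐_
infixl 7 _⨯ℚ_
infixr 8 _·_

-- Every approximation equals the rational; unlike for _≃_, congruence for the
-- operations then needs no estimates.
_≐_ : Vec ℝ n → Vec ℚ n → Set
_≐_ = Pointwise (λ x q → ∀ k → seq x k ≡ q)

_⨯ℚ_ : ℚ³ → ℚ³ → ℚ³
(a₁ ∷ a₂ ∷ a₃ ∷ []) ⨯ℚ (b₁ ∷ b₂ ∷ b₃ ∷ []) =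
  (a₂ ℚ.* b₃ ℚ.- a₃ ℚ.* b₂) ∷
  (a₃ ℚ.* b₁ ℚ.- a₁ ℚ.* b₃) ∷
  (a₁ ℚ.* b₂ ℚ.- a₂ ℚ.* b₁) ∷ []

_·_ : ℚ → ℚ³ → ℚ³
q · v = map (q ℚ.*_) v

0ℚ³ : ℚ³
0ℚ³ = 0ℚ ∷ 0ℚ ∷ 0ℚ ∷ []

⨯-≐ : ∀ {u v p q} → u ≐ p → v ≐ q → u ⨯ v ≐ p ⨯ℚ q
⨯-≐ (a₁ ∷ a₂ ∷ a₃ ∷ []) (b₁ ∷ b₂ ∷ b₃ ∷ []) =
  minor a₂ b₃ a₃ b₂ ∷ minor a₃ b₁ a₁ b₃ ∷ minor a₁ b₂ a₂ b₁ ∷ []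
  where
  minor : ∀ {x y z w : ℕ → ℚ} {p q r s} →
          (∀ k → x k ≡ p) → (∀ k → y k ≡ q) → (∀ k → z k ≡ r) → (∀ k → w k ≡ s) →
          ∀ k → x k ℚ.* y k ℚ.- z k ℚ.* w k ≡ p ℚ.* q ℚ.- r ℚ.* s
  minor x y z w k = cong₂ ℚ._-_ (cong₂ ℚ._*_ (x k) (y k)) (cong₂ ℚ._*_ (z k) (w k))

≐⇒≋ : {u v : Vec ℝ n} {p : Vec ℚ n} → u ≐ p → v ≐ p → Pointwise _≃_ u v
≐⇒≋ [] [] = []
≐⇒≋ {u = x ∷ _} {y ∷ _} (x≐q ∷ u≐p) (y≐q ∷ v≐p) = constant x y x≐q y≐q ∷ ≐⇒≋ u≐p v≐p
  where
  constant : ∀ x y {q} → (∀ k → seq x k ≡ q) → (∀ k → seq y k ≡ q) → x ≃ y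
  constant x y {q} x≐q y≐q ε 0<ε = 0 , λ k _ →
    subst₂ (λ r s → ℚ.∣ r ℚ.- s ∣ ℚ.< ε) (sym (x≐q k)) (sym (y≐q k))
      (subst (λ d → ℚ.∣ d ∣ ℚ.< ε) (sym (ℚ.+-inverseʳ q)) 0<ε)

-- If two coordinates differed, their distance would itself be a positive tolerance, and closeness
-- would make it smaller than itself.
≋⇒≡ : {u v : Vec ℝ n} {p q : Vec ℚ n} → Pointwise _≃_ u v → u ≐ p → v ≐ q → p ≡ q
≋⇒≡ [] [] [] = refl
≋⇒≡ {u = x ∷ _} {y ∷ _} (x≃y ∷ u≋v) (x≐p ∷ u≐p) (y≐q ∷ v≐q) =
  cong₂ _∷_ (constant x y x≃y x≐p y≐q) (≋⇒≡ u≋v u≐p v≐q)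
  where
  constant : ∀ x y {p q} → x ≃ y → (∀ k → seq x k ≡ p) → (∀ k → seq y k ≡ q) → p ≡ q
  constant x y {p} {q} x≃y x≐p y≐q with ℚ.∣ p ℚ.- q ∣ ℚ.≟ 0ℚ
  ... | yes eq = ℚ+.x∙y⁻¹≈ε⇒x≈y p q (ℚ.∣p∣≡0⇒p≡0 _ eq)
  ... | no neq
    with N , close ← x≃y ℚ.∣ p ℚ.- q ∣ (ℚ.≰⇒> λ d≤0 → neq (ℚ.≤-antisym d≤0 (ℚ.0≤∣p∣ _)))
    = ⊥-elim (ℚ.<-irrefl (cong₂ (λ r s → ℚ.∣ r ℚ.- s ∣) (x≐p N) (y≐q N)) (close N ℕ.≤-refl))

-- Identities of the rational cross product

·-⨯ℚ-· : ∀ σ τ p q → (σ · p) ⨯ℚ (τ · q) ≡ (σ ℚ.* τ) · (p ⨯ℚ q)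
·-⨯ℚ-· σ τ (a₁ ∷ a₂ ∷ a₃ ∷ []) (b₁ ∷ b₂ ∷ b₃ ∷ []) =
  Pointwise-≡⇒≡ (minor a₂ b₃ a₃ b₂ ∷ minor a₃ b₁ a₁ b₃ ∷ minor a₁ b₂ a₂ b₁ ∷ [])
  where
  minor : ∀ a b c d → (σ ℚ.* a) ℚ.* (τ ℚ.* b) ℚ.- (σ ℚ.* c) ℚ.* (τ ℚ.* d)
                      ≡ (σ ℚ.* τ) ℚ.* (a ℚ.* b ℚ.- c ℚ.* d)
  minor = solve 6 (λ σ τ a b c d → (σ :* a) :* (τ :* b) :- (σ :* c) :* (τ :* d)
                                   := (σ :* τ) :* (a :* b :- c :* d)) refl σ τ
    where open ℚ.+-*-Solver

⨯ℚ-parallel : ∀ σ τ p → (σ · p) ⨯ℚ (τ · p) ≡ 0ℚ³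
⨯ℚ-parallel σ τ (a₁ ∷ a₂ ∷ a₃ ∷ []) =
  Pointwise-≡⇒≡ (minor a₂ a₃ ∷ minor a₃ a₁ ∷ minor a₁ a₂ ∷ [])
  where
  minor : ∀ a b → (σ ℚ.* a) ℚ.* (τ ℚ.* b) ℚ.- (σ ℚ.* b) ℚ.* (τ ℚ.* a) ≡ 0ℚ
  minor = solve 4 (λ σ τ a b → (σ :* a) :* (τ :* b) :- (σ :* b) :* (τ :* a)
                               := con 0ℚ) refl σ τ
    where open ℚ.+-*-Solver

⨯ℚ-zeroˡ : ∀ p → 0ℚ³ ⨯ℚ p ≡ 0ℚ³
⨯ℚ-zeroˡ (a₁ ∷ a₂ ∷ a₃ ∷ []) =
  Pointwise-≡⇒≡ (minor a₃ a₂ ∷ minor a₁ a₃ ∷ minor a₂ a₁ ∷ [])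
  where
  minor : ∀ a b → 0ℚ ℚ.* a ℚ.- 0ℚ ℚ.* b ≡ 0ℚ
  minor = solve 2 (λ a b → con 0ℚ :* a :- con 0ℚ :* b := con 0ℚ) refl
    where open ℚ.+-*-Solver

⨯ℚ-zeroʳ : ∀ p → p ⨯ℚ 0ℚ³ ≡ 0ℚ³
⨯ℚ-zeroʳ (a₁ ∷ a₂ ∷ a₃ ∷ []) =
  Pointwise-≡⇒≡ (minor a₂ a₃ ∷ minor a₃ a₁ ∷ minor a₁ a₂ ∷ [])
  where
  minor : ∀ a b → a ℚ.* 0ℚ ℚ.- b ℚ.* 0ℚ ≡ 0ℚ
  minor = solve 2 (λ a b → a :* con 0ℚ :- b :* con 0ℚ := con 0ℚ) refl
    where open ℚ.+-*-Solver

-- Signed unit vectors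

unit : Symbol → ℝ³
unit 0F = î
unit 1F = ĵ
unit 2F = k̂

unitℚ : Symbol → ℚ³
unitℚ 0F = 1ℚ ∷ 0ℚ ∷ 0ℚ ∷ []
unitℚ 1F = 0ℚ ∷ 1ℚ ∷ 0ℚ ∷ []
unitℚ 2F = 0ℚ ∷ 0ℚ ∷ 1ℚ ∷ []

signℚ : Sign → ℚ
signℚ Sign.+ = 1ℚ
signℚ Sign.- = ℚ.- 1ℚ

signedUnit : Sign → Symbol → ℚ³
signedUnit s a = signℚ s · unitℚ a

signℚ-* : ∀ s t → signℚ s ℚ.* signℚ t ≡ signℚ (s Sign.* t)
signℚ-* Sign.+ Sign.+ = refl
signℚ-* Sign.+ Sign.- = refl
signℚ-* Sign.- Sign.+ = refl
signℚ-* Sign.- Sign.- = refl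

·-signedUnit : ∀ s t a → signℚ s · signedUnit t a ≡ signedUnit (s Sign.* t) a
·-signedUnit s t a = begin
  signℚ s · (signℚ t · unitℚ a)     ≡⟨ map-∘ _ _ (unitℚ a) ⟨
  map _ (unitℚ a)                   ≡⟨ map-cong (λ q → sym (ℚ.*-assoc (signℚ s) (signℚ t) q)) (unitℚ a) ⟩
  (signℚ s ℚ.* signℚ t) · unitℚ a   ≡⟨ cong (_· unitℚ a) (signℚ-* s t) ⟩
  signedUnit (s Sign.* t) a         ∎
  where open ≡-Reasoning

-- The sign is the one in `rule-•`; this coincidence ties the cross product to the associative
-- quaternion product.
rule-⨯ℚ : (ρ : c ⟶ a , b) → unitℚ a ⨯ℚ unitℚ b ≡ signedUnit (ruleSign ρ) c
rule-⨯ℚ 0⟶12 = refl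
rule-⨯ℚ 0⟶21 = refl
rule-⨯ℚ 1⟶02 = refl
rule-⨯ℚ 1⟶20 = refl
rule-⨯ℚ 2⟶01 = refl
rule-⨯ℚ 2⟶10 = refl

signedUnit-⨯ℚ : ∀ s t (ρ : c ⟶ a , b) →
  signedUnit s a ⨯ℚ signedUnit t b ≡ signedUnit (s Sign.* (t Sign.* ruleSign ρ)) c
signedUnit-⨯ℚ {c} {a} {b} s t ρ = begin
  signedUnit s a ⨯ℚ signedUnit t b                 ≡⟨ ·-⨯ℚ-· (signℚ s) (signℚ t) (unitℚ a) (unitℚ b) ⟩
  (signℚ s ℚ.* signℚ t) · (unitℚ a ⨯ℚ unitℚ b)     ≡⟨ cong₂ _·_ (signℚ-* s t) (rule-⨯ℚ ρ) ⟩
  signℚ (s Sign.* t) · signedUnit (ruleSign ρ) c   ≡⟨ ·-signedUnit (s Sign.* t) (ruleSign ρ) c ⟩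
  -- Reassociated to the shape of `treeSign` at a node.
  signedUnit ((s Sign.* t) Sign.* ruleSign ρ) c    ≡⟨ cong (λ u → signedUnit u c) (Sign.*-assoc s t (ruleSign ρ)) ⟩
  signedUnit (s Sign.* (t Sign.* ruleSign ρ)) c    ∎
  where open ≡-Reasoning

signedUnit≢0 : ∀ s a → ¬ (signedUnit s a ≡ 0ℚ³)
signedUnit≢0 Sign.+ 0F ()
signedUnit≢0 Sign.+ 1F ()
signedUnit≢0 Sign.+ 2F ()
signedUnit≢0 Sign.- 0F ()
signedUnit≢0 Sign.- 1F ()
signedUnit≢0 Sign.- 2F ()

0⃗≐0 : 0⃗ ≐ 0ℚ³
0⃗≐0 = (λ _ → refl) ∷ (λ _ → refl) ∷ (λ _ → refl) ∷ []

unit≐signedUnit : ∀ a → unit a ≐ signedUnit Sign.+ a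
unit≐signedUnit 0F = (λ _ → refl) ∷ (λ _ → refl) ∷ (λ _ → refl) ∷ []
unit≐signedUnit 1F = (λ _ → refl) ∷ (λ _ → refl) ∷ (λ _ → refl) ∷ []
unit≐signedUnit 2F = (λ _ → refl) ∷ (λ _ → refl) ∷ (λ _ → refl) ∷ []

unit∈standardUnitVectors : ∀ a → unit a ∈ standardUnitVectors
unit∈standardUnitVectors 0F = here refl
unit∈standardUnitVectors 1F = there (here refl)
unit∈standardUnitVectors 2F = there (there (here refl))

-- The position of each vector in the list is its letter.
units-of-word : {vs : Vec ℝ³ n} → All (_∈ standardUnitVectors) vs →
                ∃[ w ] map unit w ≡ vs
units-of-word []                                = [] , refl
units-of-word (here refl ∷ vs∈)                 with w , refl ← units-of-word vs∈ = 0F ∷ w , refl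
units-of-word (there (here refl) ∷ vs∈)         with w , refl ← units-of-word vs∈ = 1F ∷ w , refl
units-of-word (there (there (here refl)) ∷ vs∈) with w , refl ← units-of-word vs∈ = 2F ∷ w , refl

-- Evaluation of bracketings

evaluate-node-++ : (l : Bracketing m) (r : Bracketing n) (us : Vec ℝ³ m) (vs : Vec ℝ³ n) →
                   evaluate (node l r) (us ++ vs) ≡ evaluate l us ⨯ evaluate r vs
evaluate-node-++ {m} l r us vs
  -- `evaluate` cuts with `take` and `drop`, while leaf words are concatenations; injectivity of
  -- `_++_` identifies the pieces.
  with us≡ , vs≡ ← ++-injective (take m (us ++ vs)) us (take++drop≡id m (us ++ vs))
  = cong₂ (λ xs ys → evaluate l xs ⨯ evaluate r ys) us≡ vs≡

evaluate-node : ∀ (l : Bracketing m) (r : Bracketing n) (u : Word m) (v : Word n) {p q} →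
                evaluate l (map unit u) ≐ p → evaluate r (map unit v) ≐ q →
                evaluate (node l r) (map unit (u ++ v)) ≐ p ⨯ℚ q
evaluate-node l r u v {p} {q} l≐p r≐q = subst (_≐ p ⨯ℚ q) (sym split) (⨯-≐ l≐p r≐q)
  where
  split = trans (cong (evaluate (node l r)) (map-++ unit u v))
                (evaluate-node-++ l r (map unit u) (map unit v))

-- The induction parallels `act-leafWord`, producing the same sign and root label.
evaluate-leafWord : (t : BinaryTree n) (ℓ : Labeling t) (o : ObeysRules t ℓ) →
  evaluate t (map unit (leafWord t ℓ)) ≐ signedUnit (treeSign t ℓ o) (ℓ root)
evaluate-leafWord leaf       ℓ _             = unit≐signedUnit (ℓ root)
evaluate-leafWord (node l r) ℓ (ρ , ol , or) =
  subst (_ ≐_) (signedUnit-⨯ℚ (treeSign l _ ol) (treeSign r _ or) ρ)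
    (evaluate-node l r (leafWord l _) (leafWord r _)
      (evaluate-leafWord l _ ol) (evaluate-leafWord r _ or))

-- A zero value at a subtree propagates upward. If both subtrees parse, distinct root labels extend
-- the labeling to the new root, and equal ones give parallel factors.
parses-or-zero : (t : BinaryTree n) (w : Word n) →
                 Parses t w ⊎ evaluate t (map unit w) ≐ 0ℚ³
parses-or-zero leaf (a ∷ []) = inj₁ ((λ _ → a) , refl , tt)
parses-or-zero (node {m} l r) w
  with u , v , refl ← splitAt m w
  with parses-or-zero l u | parses-or-zero r v
... | inj₂ l≐0 | inj₁ (ℓ₂ , refl , o₂) = inj₂ (subst (_ ≐_) (⨯ℚ-zeroˡ _)
        (evaluate-node l r u v l≐0 (evaluate-leafWord r ℓ₂ o₂)))
-- The product of two zero vectors reduces to `0ℚ³` by computation.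
... | inj₂ l≐0 | inj₂ r≐0 = inj₂ (evaluate-node l r u v l≐0 r≐0)
... | inj₁ (ℓ₁ , refl , o₁) | inj₂ r≐0 = inj₂ (subst (_ ≐_) (⨯ℚ-zeroʳ _)
        (evaluate-node l r u v (evaluate-leafWord l ℓ₁ o₁) r≐0))
... | inj₁ (ℓ₁ , refl , o₁) | inj₁ (ℓ₂ , refl , o₂)
  with equal-or-rule (ℓ₁ root) (ℓ₂ root)
... | inj₂ (c , ρ) = inj₁ (joinLabelings c ℓ₁ ℓ₂ , refl , ρ , o₁ , o₂)
... | inj₁ eq      = inj₂ (subst (_ ≐_) parallel
        (evaluate-node l r u v (evaluate-leafWord l ℓ₁ o₁) (evaluate-leafWord r ℓ₂ o₂)))
  where
  s = treeSign l ℓ₁ o₁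
  t = treeSign r ℓ₂ o₂

  parallel : signedUnit s (ℓ₁ root) ⨯ℚ signedUnit t (ℓ₂ root) ≡ 0ℚ³
  parallel = trans (cong (λ a → signedUnit s a ⨯ℚ signedUnit t (ℓ₂ root)) eq)
                   (⨯ℚ-parallel (signℚ s) (signℚ t) (unitℚ (ℓ₂ root)))

evaluate-nonzero⇒parses : (t : BinaryTree n) (w : Word n) →
                          ¬ (evaluate t (map unit w) ≋ 0⃗) → Parses t w
evaluate-nonzero⇒parses t w t≢0 with parses-or-zero t w
... | inj₁ parses = parses
... | inj₂ t≐0    = ⊥-elim (t≢0 (≐⇒≋ t≐0 0⃗≐0))

-- The two implications

ambiguous⇒agree : TotallyAmbiguous → AgreeNonzeroOnUnitVectors
ambiguous⇒agree ambiguous n n≥1 t₁ t₂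
  with w , (ℓ₁ , refl , o₁) , (ℓ₂ , w≡ , o₂) ← ambiguous n n≥1 t₁ t₂
  = map unit w , map⁺ (All.universal unit∈standardUnitVectors w) , ≐⇒≋ t₁≐ t₂≐ ,
    λ t₁≋0 → signedUnit≢0 (treeSign t₁ ℓ₁ o₁) (ℓ₁ root) (≋⇒≡ t₁≋0 t₁≐ 0⃗≐0)
  where
  t₁≐ = evaluate-leafWord t₁ ℓ₁ o₁

  t₂≐ : evaluate t₂ (map unit w) ≐ signedUnit (treeSign t₁ ℓ₁ o₁) (ℓ₁ root)
  -- The quaternion action turns the signed unit of `t₂` into that of `t₁`, although the cross
  -- product itself is not associative.
  t₂≐ with signs , roots ← leafWord-determines-root t₂ t₁ ℓ₂ ℓ₁ o₂ o₁ w≡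
    = subst₂ (λ w p → evaluate t₂ (map unit w) ≐ p) w≡ (cong₂ signedUnit signs roots)
        (evaluate-leafWord t₂ ℓ₂ o₂)

agree⇒ambiguous : AgreeNonzeroOnUnitVectors → TotallyAmbiguous
agree⇒ambiguous agree n n≥1 t₁ t₂
  with vs , vs∈ , t₁≋t₂ , t₁≢0 ← agree n n≥1 t₁ t₂
  with w , refl ← units-of-word vs∈
  with parses₁@(ℓ₁ , refl , o₁) ← evaluate-nonzero⇒parses t₁ w t₁≢0
  with parses-or-zero t₂ w
... | inj₁ parses₂ = w , parses₁ , parses₂
-- A zero value for `t₂` would equal the value of `t₁`, which is a signed unit because `t₁` parses
-- `w`.
... | inj₂ t₂≐0    = ⊥-elim (signedUnit≢0 (treeSign t₁ ℓ₁ o₁) (ℓ₁ root)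
        (≋⇒≡ t₁≋t₂ (evaluate-leafWord t₁ ℓ₁ o₁) t₂≐0))

mainTheorem11 : TotallyAmbiguous ⇔ AgreeNonzeroOnUnitVectors
mainTheorem11 = mk⇔ ambiguous⇒agree agree⇒ambiguous
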